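{- Let $p>3$ be a prime number. Then $$\sum_{k=0}^{p-1}(-1)^k\,k\,H_k\equiv\frac{1}{2}\,H'_{p-1}\pmod p .$$
   Context: $H_k=\sum_{j=1}^{k}\frac1j$ denotes the $k$-th harmonic number, with $H_0:=0$. For an odd prime $p$, $H'_{p-1}:=1+\frac13+\frac15+\dots+\frac1{p-2}$ is the sum of the reciprocals of the odd integers between $1$ and $p-2$. Congruences modulo $p$ are between rational numbers whose denominators are prime to $p$ (i.e. congruences in the localization $\mathbb{Z}_{(p)}$). -}

module Defs where

open import Data.Fin.Base using (toℕ)
open import Data.Integer.Base as ℤ using (+_; 1ℤ; -1ℤ)
open import Data.Nat.Base as ℕ using (ℕ; suc; ⌊_/2⌋)
open import Data.Nat.Coprimality using (Coprime)
open import Data.Product.Base using (∃; _×_)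
open import Data.Rational.Base using (ℚ; _/_; _*_; _-_; ↧ₙ_)
open import Data.Rational.Properties using (+-0-monoid)
open import Relation.Binary.PropositionalEquality.Core using (_≡_)

open import Algebra.Properties.Monoid.Sum +-0-monoid public using (sum; sum-syntax)

H : ℕ → ℚ
H k = ∑[ i < k ] (1ℤ / suc (toℕ i))

-- For even n the summation index runs through the odd integers 2i + 1 from
-- 1 to n - 1, so H′ (p ∸ 1) = 1 + 1/3 + … + 1/(p - 2) when p is odd.
H′ : ℕ → ℚ
H′ n = ∑[ i < ⌊ n /2⌋ ] (1ℤ / suc (2 ℕ.* toℕ i))

[-1]^_ : ℕ → ℚ
[-1]^ k = (-1ℤ ℤ.^ k) / 1

-- Membership in the localization of ℤ at p; ↧ₙ x is the denominator of x in
-- lowest terms.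
_∈ℤ₍_₎ : ℚ → ℕ → Set
x ∈ℤ₍ p ₎ = Coprime (↧ₙ x) p

infix 4 _≡_[mod_]

-- Congruence modulo the ideal generated by p in that localization.
record _≡_[mod_] (x y : ℚ) (p : ℕ) : Set where
  field
    integralˡ  : x ∈ℤ₍ p ₎
    integralʳ  : y ∈ℤ₍ p ₎
    difference : ∃ λ z → z ∈ℤ₍ p ₎ × x - y ≡ (+ p / 1) * z

{-# OPTIONS --safe #-}
-- Write p = 2m + 1. Induction on m gives the exact identity
-- ∑_{k ≤ 2m} (-1)^k k H_k = m H_{2m} + ½ H′_{2m}, and H_{p-1} vanishes modulo p
-- because 1/j + 1/(p - j) = p / (j (p - j)).
module Submission where

open import Defs
open import Data.Fin.Base using (Fin; zero; suc; toℕ)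
open import Data.Fin.Properties using (toℕ<n; toℕ-inject₁; toℕ-fromℕ)
open import Data.Integer.Base as ℤ using (+_; 1ℤ; -1ℤ)
import Data.Integer.Properties as ℤ
open import Data.Integer.GCD using (gcd)
open import Data.Nat.Base as ℕ using (ℕ; zero; suc; _<_; _∸_; NonZero; z≤n; s≤s)
import Data.Nat.Properties as ℕ
open import Data.Nat.Coprimality as Coprimality
  using (Coprime; coprime-divisor; prime⇒coprime; 1-coprimeTo)
open import Data.Nat.Divisibility using (_∣_; divides; ∣-refl; ∣-trans)
open import Data.Nat.Primality using (Prime)
open import Data.Product.Base using (∃; _×_; _,_)
open import Data.Rational.Base using (ℚ; 0ℚ; 1ℚ; ½; _/_; _+_; _*_; _-_; -_; ↥_; ↧_; ↧ₙ_; fromℚᵘ; toℚᵘ)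
open import Data.Rational.Properties
  using (+-comm; *-zeroʳ; +-0-commutativeMonoid;
         ↧-/; fromℚᵘ-cong; toℚᵘ-fromℚᵘ; toℚᵘ-injective; toℚᵘ-homo-+; toℚᵘ-homo-*)
open import Data.Rational.Solver using (module +-*-Solver)
import Data.Rational.Unnormalised.Base as ℚᵘ
import Data.Rational.Unnormalised.Properties as ℚᵘ
open import Data.Sum.Base using (_⊎_; inj₁; inj₂)
open import Function.Base using (_∘_)
open import Relation.Binary.PropositionalEquality
open import Relation.Nullary.Negation using (contradiction)

open import Algebra.Properties.CommutativeMonoid.Sum +-0-commutativeMonoid
  using (∑-distrib-+; sum-cong-≗; sum-init-last)

open +-*-Solver

-- With p = 2m + 1, an exact rational identity (`alternating-sum`) shows that the alternating sum
-- exceeds ½ H′ by exactly m H_{p-1} = (½ m)(H_{p-1} + H_{p-1}). Reversing one copy of H_{p-1} pairs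
-- 1/j with 1/(p - j), and each pair is p times 1/(j (p - j)), whose denominator is prime to p; so p
-- divides the doubled sum (`p∣2H`), and the p-integral factor ½ m preserves this. Integrality of
-- everything in sight reduces to the fact that 1, ..., p - 1 are prime to p.

fromℚᵘ-homo-+ : ∀ x y → fromℚᵘ (x ℚᵘ.+ y) ≡ fromℚᵘ x + fromℚᵘ y
fromℚᵘ-homo-+ x y = toℚᵘ-injective (begin
  toℚᵘ (fromℚᵘ (x ℚᵘ.+ y))                 ≈⟨ toℚᵘ-fromℚᵘ (x ℚᵘ.+ y) ⟩
  x ℚᵘ.+ y                                 ≈⟨ ℚᵘ.+-cong (toℚᵘ-fromℚᵘ x) (toℚᵘ-fromℚᵘ y) ⟨
  toℚᵘ (fromℚᵘ x) ℚᵘ.+ toℚᵘ (fromℚᵘ y)     ≈⟨ toℚᵘ-homo-+ (fromℚᵘ x) (fromℚᵘ y) ⟨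
  toℚᵘ (fromℚᵘ x + fromℚᵘ y)               ∎)
  where open import Relation.Binary.Reasoning.Setoid ℚᵘ.≃-setoid

fromℚᵘ-homo-* : ∀ x y → fromℚᵘ (x ℚᵘ.* y) ≡ fromℚᵘ x * fromℚᵘ y
fromℚᵘ-homo-* x y = toℚᵘ-injective (begin
  toℚᵘ (fromℚᵘ (x ℚᵘ.* y))                 ≈⟨ toℚᵘ-fromℚᵘ (x ℚᵘ.* y) ⟩
  x ℚᵘ.* y                                 ≈⟨ ℚᵘ.*-cong (toℚᵘ-fromℚᵘ x) (toℚᵘ-fromℚᵘ y) ⟨
  toℚᵘ (fromℚᵘ x) ℚᵘ.* toℚᵘ (fromℚᵘ y)     ≈⟨ toℚᵘ-homo-* (fromℚᵘ x) (fromℚᵘ y) ⟨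
  toℚᵘ (fromℚᵘ x * fromℚᵘ y)               ∎)
  where open import Relation.Binary.Reasoning.Setoid ℚᵘ.≃-setoid

-- Normalisation by the gcd is stuck on variables, so the identity is checked by
-- cross-multiplication on unnormalised fractions and carried over by `fromℚᵘ`.
fromℕ-homo-+ : ∀ m n → + (m ℕ.+ n) / 1 ≡ + m / 1 + + n / 1
fromℕ-homo-+ m n = trans
  (fromℚᵘ-cong {ℚᵘ.mkℚᵘ (+ (m ℕ.+ n)) 0} {ℚᵘ.mkℚᵘ (+ m) 0 ℚᵘ.+ ℚᵘ.mkℚᵘ (+ n) 0}
    (ℚᵘ.*≡* (cong (ℤ._* 1ℤ) (sym (cong₂ ℤ._+_ (ℤ.*-identityʳ (+ m)) (ℤ.*-identityʳ (+ n)))))))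
  (fromℚᵘ-homo-+ (ℚᵘ.mkℚᵘ (+ m) 0) (ℚᵘ.mkℚᵘ (+ n) 0))

n*1/n≡1 : ∀ n → (+ suc n / 1) * (1ℤ / suc n) ≡ 1ℚ
n*1/n≡1 n = trans
  (sym (fromℚᵘ-homo-* (ℚᵘ.mkℚᵘ (+ suc n) 0) (ℚᵘ.mkℚᵘ 1ℤ n)))
  (fromℚᵘ-cong {ℚᵘ.mkℚᵘ (+ suc n) 0 ℚᵘ.* ℚᵘ.mkℚᵘ 1ℤ n} {ℚᵘ.mkℚᵘ 1ℤ 0}
    (ℚᵘ.*≡* (cong +_ (cross n))))
  where
  cross : ∀ n → suc n ℕ.* 1 ℕ.* 1 ≡ 1 ℕ.* (1 ℕ.* suc n)
  cross n = begin
    suc n ℕ.* 1 ℕ.* 1    ≡⟨ ℕ.*-identityʳ (suc n ℕ.* 1) ⟩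
    suc n ℕ.* 1          ≡⟨ ℕ.*-comm (suc n) 1 ⟩
    1 ℕ.* suc n          ≡⟨ ℕ.*-identityˡ (1 ℕ.* suc n) ⟨
    1 ℕ.* (1 ℕ.* suc n)  ∎
    where open ≡-Reasoning

1/a+1/b : ∀ a b → 1ℤ / suc a + 1ℤ / suc b ≡
          (+ (suc a ℕ.+ suc b) / 1) * ((1ℤ / suc a) * (1ℤ / suc b))
1/a+1/b a b = begin
  x + y                    ≡⟨ solve 2 (λ x y → x :+ y := con 1ℚ :* y :+ con 1ℚ :* x) refl x y ⟩
  -- Each 1 is expanded as a denominator times its reciprocal, which brings out the common factor
  -- `x * y`.
  1ℚ * y + 1ℚ * x          ≡⟨ cong₂ (λ u v → u * y + v * x) (n*1/n≡1 a) (n*1/n≡1 b) ⟨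
  A * x * y + B * y * x    ≡⟨ solve 4 (λ A B x y → A :* x :* y :+ B :* y :* x := (A :+ B) :* (x :* y)) refl A B x y ⟩
  (A + B) * (x * y)        ≡⟨ cong (_* (x * y)) (fromℕ-homo-+ (suc a) (suc b)) ⟨
  (+ (suc a ℕ.+ suc b) / 1) * (x * y) ∎
  where
  open ≡-Reasoning
  x = 1ℤ / suc a
  y = 1ℤ / suc b
  A = + suc a / 1
  B = + suc b / 1

∑-snoc : ∀ (f : ℕ → ℚ) n → ∑[ i < suc n ] f (toℕ i) ≡ ∑[ i < n ] f (toℕ i) + f n
∑-snoc f n = trans (sum-init-last {n} (f ∘ toℕ))
  (cong₂ _+_ (sum-cong-≗ {n} (cong f ∘ toℕ-inject₁)) (cong f (toℕ-fromℕ n)))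

-- The first term of the reversed sum is the last term of the original, so one side is peeled at the
-- head and the other at the end.
∑-reverse : ∀ (f : ℕ → ℚ) n → ∑[ i < n ] f (n ∸ suc (toℕ i)) ≡ ∑[ i < n ] f (toℕ i)
∑-reverse f zero    = refl
∑-reverse f (suc n) = begin
  f n + ∑[ i < n ] f (n ∸ suc (toℕ i))  ≡⟨ cong (λ s → f n + s) (∑-reverse f n) ⟩
  f n + ∑[ i < n ] f (toℕ i)            ≡⟨ +-comm (f n) _ ⟩
  ∑[ i < n ] f (toℕ i) + f n            ≡⟨ ∑-snoc f n ⟨
  ∑[ i < suc n ] f (toℕ i)              ∎
  where open ≡-Reasoning

module _ {p : ℕ} where

  coprime-*ˡ : ∀ {m n} → Coprime m p → Coprime n p → Coprime (m ℕ.* n) p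
  coprime-*ˡ m⊥p n⊥p (d∣mn , d∣p) =
    n⊥p (coprime-divisor (λ (e∣d , e∣m) → m⊥p (e∣m , ∣-trans e∣d d∣p)) d∣mn , d∣p)

  -- Cancelling the gcd replaces `n` by one of its divisors, so any representation with denominator
  -- prime to `p`, reduced or not, proves integrality.
  /-integral : ∀ i n .{{_ : NonZero n}} → Coprime n p → (i / n) ∈ℤ₍ p ₎
  /-integral i n n⊥p (d∣↧ , d∣p) = n⊥p (∣-trans d∣↧ ↧∣n , d∣p)
    where
    ↧∣n : ↧ₙ (i / n) ∣ n
    ↧∣n = divides ℤ.∣ gcd i (+ n) ∣ (begin
      n                                              ≡⟨ cong ℤ.∣_∣ (↧-/ i n) ⟨
      ℤ.∣ + ↧ₙ (i / n) ℤ.* gcd i (+ n) ∣             ≡⟨ ℤ.abs-* (+ ↧ₙ (i / n)) (gcd i (+ n)) ⟩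
      ↧ₙ (i / n) ℕ.* ℤ.∣ gcd i (+ n) ∣               ≡⟨ ℕ.*-comm (↧ₙ (i / n)) _ ⟩
      ℤ.∣ gcd i (+ n) ∣ ℕ.* ↧ₙ (i / n)               ∎)
      where open ≡-Reasoning

  ℤ-integral : ∀ i → (i / 1) ∈ℤ₍ p ₎
  ℤ-integral i = /-integral i 1 (1-coprimeTo p)

  +-integral : ∀ x y → x ∈ℤ₍ p ₎ → y ∈ℤ₍ p ₎ → (x + y) ∈ℤ₍ p ₎
  -- Matching on the records lets `x + y` unfold to a quotient over the product of the denominators.
  +-integral x@record{} y@record{} x∈ y∈ =
    /-integral (↥ x ℤ.* ↧ y ℤ.+ ↥ y ℤ.* ↧ x) (↧ₙ x ℕ.* ↧ₙ y) (coprime-*ˡ x∈ y∈)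

  *-integral : ∀ x y → x ∈ℤ₍ p ₎ → y ∈ℤ₍ p ₎ → (x * y) ∈ℤ₍ p ₎
  *-integral x@record{} y@record{} x∈ y∈ =
    /-integral (↥ x ℤ.* ↥ y) (↧ₙ x ℕ.* ↧ₙ y) (coprime-*ˡ x∈ y∈)

  sum-integral : ∀ n (t : Fin n → ℚ) → (∀ i → t i ∈ℤ₍ p ₎) → sum t ∈ℤ₍ p ₎
  sum-integral zero    t t∈ = ℤ-integral (+ 0)
  sum-integral (suc n) t t∈ =
    +-integral (t zero) (sum (t ∘ suc)) (t∈ zero) (sum-integral n (t ∘ suc) (t∈ ∘ suc))

  infix 4 p∣_
  -- Membership in the ideal generated by p, in the same shape as the field `difference` of the
  -- congruence.
  p∣_ : ℚ → Set
  p∣ x = ∃ λ z → z ∈ℤ₍ p ₎ × x ≡ (+ p / 1) * z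

  p∣sum : ∀ n (t : Fin n → ℚ) → (∀ i → p∣ t i) → p∣ sum t
  p∣sum zero    t p∣t = 0ℚ , ℤ-integral (+ 0) , sym (*-zeroʳ (+ p / 1))
  p∣sum (suc n) t p∣t with p∣t zero | p∣sum n (t ∘ suc) (p∣t ∘ suc)
  ... | z , z∈ , t₀≡pz | w , w∈ , ∑t≡pw = z + w , +-integral z w z∈ w∈ ,
    trans (cong₂ _+_ t₀≡pz ∑t≡pw)
      (solve 3 (λ p z w → p :* z :+ p :* w := p :* (z :+ w)) refl (+ p / 1) z w)

  p∣-*ˡ : ∀ c x → c ∈ℤ₍ p ₎ → p∣ x → p∣ c * x
  p∣-*ˡ c x c∈ (z , z∈ , x≡pz) = c * z , *-integral c z c∈ z∈ ,
    trans (cong (c *_) x≡pz)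
      (solve 3 (λ p c z → c :* (p :* z) := p :* (c :* z)) refl (+ p / 1) c z)

  module _ (p-prime : Prime p) where

    1/n-integral : ∀ n → suc n < p → (1ℤ / suc n) ∈ℤ₍ p ₎
    1/n-integral n n<p = /-integral 1ℤ (suc n) (Coprimality.sym (prime⇒coprime p-prime n<p))

    H-integral : ∀ n → n < p → H n ∈ℤ₍ p ₎
    H-integral n n<p = sum-integral n _ λ i →
      1/n-integral (toℕ i) (ℕ.≤-<-trans (toℕ<n i) n<p)

    -- Doubling lets the involution j ↦ p - j act on the whole range, with no need to split it into
    -- halves.
    p∣2H : ∀ n → suc n ≡ p → p∣ H n + H n
    p∣2H n refl = subst p∣_ pairing (p∣sum n pair p∣pair)
      where
      pair : Fin n → ℚ
      -- With j = i + 1 and p = n + 1, the second denominator is p - j.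
      pair i = 1ℤ / suc (toℕ i) + 1ℤ / suc (n ∸ suc (toℕ i))
      pairing : sum pair ≡ H n + H n
      pairing = trans
        (∑-distrib-+ {n} (λ i → 1ℤ / suc (toℕ i)) (λ i → 1ℤ / suc (n ∸ suc (toℕ i))))
        (cong (λ s → H n + s) (∑-reverse (λ i → 1ℤ / suc i) n))
      p∣pair : ∀ i → p∣ pair i
      p∣pair i = z , *-integral (1ℤ / suc a) (1ℤ / suc b)
          (1/n-integral a (s≤s (toℕ<n i)))
          (1/n-integral b (s≤s b<n)) ,
        trans (1/a+1/b a b) (cong (λ s → (+ s / 1) * z) a+b≡p)
        where
        a = toℕ i
        b = n ∸ suc a
        z = (1ℤ / suc a) * (1ℤ / suc b)
        b<n : b < n
        b<n = ℕ.∸-monoʳ-< {n} {suc a} {0} (s≤s z≤n) (toℕ<n i)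
        a+b≡p : suc a ℕ.+ suc b ≡ suc n
        a+b≡p = trans (ℕ.+-suc (suc a) b) (cong suc (ℕ.m+[n∸m]≡n (toℕ<n i)))

[-1]^2m≡1 : ∀ m → -1ℤ ℤ.^ (m ℕ.+ m) ≡ 1ℤ
[-1]^2m≡1 zero = refl
[-1]^2m≡1 (suc m) rewrite ℕ.+-suc m m | [-1]^2m≡1 m = refl

summand : ℕ → ℚ
summand k = [-1]^ k * (+ k / 1) * H k

-- `H′ (m + m)` with the floor evaluated, so that increasing `m` adds one term.
H′-half : ℕ → ℚ
H′-half m = ∑[ i < m ] (1ℤ / suc (2 ℕ.* toℕ i))

alternating-sum : ∀ m → ∑[ k < suc (m ℕ.+ m) ] summand (toℕ k) ≡
                  (+ m / 1) * H (m ℕ.+ m) + ½ * H′-half m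
alternating-sum zero = refl
alternating-sum (suc m) = begin
  ∑[ k < suc (suc m ℕ.+ suc m) ] summand (toℕ k)
    ≡⟨ cong (λ n → ∑[ k < suc (suc n) ] summand (toℕ k)) (ℕ.+-suc m m) ⟩
  ∑[ k < suc (suc (suc n)) ] summand (toℕ k)
    ≡⟨ ∑-snoc summand (suc (suc n)) ⟩
  ∑[ k < suc (suc n) ] summand (toℕ k) + summand (suc (suc n))
    ≡⟨ cong (_+ summand (suc (suc n))) (∑-snoc summand (suc n)) ⟩
  ∑[ k < suc n ] summand (toℕ k) + summand (suc n) + summand (suc (suc n))
    ≡⟨ cong₂ _+_ (cong₂ _+_ (alternating-sum m) odd) even ⟩
  M * h + ½ * o + (- 1ℚ) * (M + M + 1ℚ) * (h + a) + 1ℚ * B * (h + a + b)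
    ≡⟨ cong (λ B → M * h + ½ * o + (- 1ℚ) * (M + M + 1ℚ) * (h + a) + 1ℚ * B * (h + a + b)) B≡ ⟩
  M * h + ½ * o + (- 1ℚ) * (M + M + 1ℚ) * (h + a) + 1ℚ * (M + M + 1ℚ + 1ℚ) * (h + a + b)
    -- The two new terms are rearranged into the desired right-hand side plus half of (2m + 2) b -
    -- (2m + 1) a. Both products equal 1, so this correction vanishes.
    ≡⟨ solve 5 (λ M h o a b →
         M :* h :+ con ½ :* o :+ con (- 1ℚ) :* (M :+ M :+ con 1ℚ) :* (h :+ a)
           :+ con 1ℚ :* (M :+ M :+ con 1ℚ :+ con 1ℚ) :* (h :+ a :+ b)
         := (con 1ℚ :+ M) :* (h :+ a :+ b) :+ con ½ :* (o :+ a)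
           :+ con ½ :* ((M :+ M :+ con 1ℚ :+ con 1ℚ) :* b :- (M :+ M :+ con 1ℚ) :* a))
         refl M h o a b ⟩
  (1ℚ + M) * (h + a + b) + ½ * (o + a) + ½ * ((M + M + 1ℚ + 1ℚ) * b - (M + M + 1ℚ) * a)
    ≡⟨ cong₂ (λ u v → (1ℚ + M) * (h + a + b) + ½ * (o + a) + ½ * (u - v))
         (trans (cong (_* b) (sym B≡)) (n*1/n≡1 (suc n)))
         (trans (cong (_* a) (sym A≡)) (n*1/n≡1 n)) ⟩
  (1ℚ + M) * (h + a + b) + ½ * (o + a) + ½ * (1ℚ - 1ℚ)
    ≡⟨ solve 2 (λ x y → x :+ y :+ con ½ :* (con 1ℚ :- con 1ℚ) := x :+ y) refl
         ((1ℚ + M) * (h + a + b)) (½ * (o + a)) ⟩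
  (1ℚ + M) * (h + a + b) + ½ * (o + a)
    ≡⟨ cong₂ _+_ (cong₂ _*_ (fromℕ-homo-+ 1 m) H-suc²) (cong (½ *_) o-suc) ⟨
  (+ suc m / 1) * H (suc (suc n)) + ½ * H′-half (suc m)
    ≡⟨ cong (λ n → (+ suc m / 1) * H (suc n) + ½ * H′-half (suc m)) (ℕ.+-suc m m) ⟨
  (+ suc m / 1) * H (suc m ℕ.+ suc m) + ½ * H′-half (suc m) ∎
  where
  open ≡-Reasoning
  n = m ℕ.+ m
  M = + m / 1
  h = H n
  o = H′-half m
  a = 1ℤ / suc n
  b = 1ℤ / suc (suc n)
  A = + suc n / 1
  B = + suc (suc n) / 1
  A≡ : A ≡ M + M + 1ℚ
  A≡ = trans (fromℕ-homo-+ 1 n) (trans (+-comm 1ℚ (+ n / 1)) (cong (_+ 1ℚ) (fromℕ-homo-+ m m)))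
  B≡ : B ≡ M + M + 1ℚ + 1ℚ
  B≡ = trans (fromℕ-homo-+ 1 (suc n)) (trans (+-comm 1ℚ A) (cong (_+ 1ℚ) A≡))
  H-suc : H (suc n) ≡ h + a
  H-suc = ∑-snoc (λ i → 1ℤ / suc i) n
  H-suc² : H (suc (suc n)) ≡ h + a + b
  H-suc² = trans (∑-snoc (λ i → 1ℤ / suc i) (suc n)) (cong (_+ b) H-suc)
  o-suc : H′-half (suc m) ≡ o + a
  o-suc = trans (∑-snoc (λ i → 1ℤ / suc (2 ℕ.* i)) m)
    (cong (λ k → o + 1ℤ / suc (m ℕ.+ k)) (ℕ.+-identityʳ m))
  odd : summand (suc n) ≡ (- 1ℚ) * (M + M + 1ℚ) * (h + a)
  odd = cong₂ _*_ (cong₂ _*_ (cong (λ s → (-1ℤ ℤ.* s) / 1) ([-1]^2m≡1 m)) A≡) H-suc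
  even : summand (suc (suc n)) ≡ 1ℚ * B * (h + a + b)
  even = cong₂ _*_ (cong (_* B) (cong (λ s → (-1ℤ ℤ.* (-1ℤ ℤ.* s)) / 1) ([-1]^2m≡1 m))) H-suc²

even⊎odd : ∀ n → ∃ λ m → n ≡ m ℕ.+ m ⊎ n ≡ suc (m ℕ.+ m)
even⊎odd zero = 0 , inj₁ refl
even⊎odd (suc n) with even⊎odd n
... | m , inj₁ refl = m , inj₂ refl
... | m , inj₂ refl = suc m , inj₁ (cong suc (sym (ℕ.+-suc m m)))

odd-case : ∀ m → Prime (suc (m ℕ.+ m)) → 2 < suc (m ℕ.+ m) →
  ∑[ k < suc (m ℕ.+ m) ] summand (toℕ k) ≡ ½ * H′ (m ℕ.+ m) [mod suc (m ℕ.+ m) ]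
odd-case m p-prime 2<p = record
  { integralˡ  = sum-integral (suc n) (summand ∘ toℕ) λ k →
      *-integral ([-1]^ toℕ k * (+ toℕ k / 1)) (H (toℕ k))
        (*-integral ([-1]^ toℕ k) (+ toℕ k / 1) (ℤ-integral (-1ℤ ℤ.^ toℕ k)) (ℤ-integral (+ toℕ k)))
        (H-integral p-prime (toℕ k) (toℕ<n k))
  ; integralʳ  = *-integral ½ (H′ n) ½-integral
      (subst (λ s → s ∈ℤ₍ suc n ₎) (sym H′≡)
        (sum-integral m (λ i → 1ℤ / suc (2 ℕ.* toℕ i)) λ i →
          1/n-integral p-prime (2 ℕ.* toℕ i) (s≤s (2i<n (toℕ<n i)))))
  ; difference = subst p∣_ (sym difference)
      (p∣-*ˡ (½ * M) (H n + H n) (*-integral ½ M ½-integral (ℤ-integral (+ m))) (p∣2H p-prime n refl))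
  }
  where
  n = m ℕ.+ m
  M = + m / 1
  ½-integral : ½ ∈ℤ₍ suc n ₎
  ½-integral = 1/n-integral p-prime 1 2<p
  2i<n : ∀ {i} → i < m → 2 ℕ.* i < n
  2i<n {i} i<m = subst (λ j → i ℕ.+ j < n) (sym (ℕ.+-identityʳ i)) (ℕ.+-mono-< i<m i<m)
  H′≡ : H′ n ≡ H′-half m
  H′≡ = cong H′-half (sym (ℕ.n≡⌊n+n/2⌋ m))
  -- The two copies of ½ H′ cancel; the remaining m H is written as ½ m (H + H) to fit `p∣2H`.
  difference : ∑[ k < suc n ] summand (toℕ k) - ½ * H′ n ≡ ½ * M * (H n + H n)
  difference = trans (cong₂ (λ s t → s - ½ * t) (alternating-sum m) H′≡)
    (solve 3 (λ M h o → M :* h :+ con ½ :* o :- con ½ :* o := con ½ :* M :* (h :+ h))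
      refl M (H n) (H′-half m))

theorem1 : ∀ (p : ℕ) → Prime p → 3 < p →
    (∑[ k < p ] ([-1]^ toℕ k * (+ toℕ k / 1) * H (toℕ k))) ≡ ½ * H′ (p ∸ 1) [mod p ]
theorem1 p p-prime 3<p with even⊎odd p
... | m , inj₂ refl = odd-case m p-prime (ℕ.<-trans (ℕ.n<1+n 2) 3<p)
-- If p were even, 2 < p would make p coprime to its divisor 2, forcing 2 = 1.
... | m , inj₁ refl = contradiction
  (prime⇒coprime p-prime 2<p (2∣m+m , ∣-refl)) λ ()
  where
  2<p : 2 < m ℕ.+ m
  2<p = ℕ.<-trans (ℕ.n<1+n 2) 3<p
  2∣m+m : 2 ∣ m ℕ.+ m
  2∣m+m = divides m (trans (cong (m ℕ.+_) (sym (ℕ.+-identityʳ m))) (ℕ.*-comm 2 m))
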